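{- Let $G$ be a $\mathfrak{Small}$-ary clone on a small set $A$. Then $G^{\perp(\mathfrak{Small})}$ is the set of all $\mathfrak{Small}$-ary operations $f:A^X \rightarrow A$ such that $h(f) = f(h \circ u_X)$ for every operation $h:A^{(A^X)} \rightarrow A$ of arity $A^X$ in $G$, where $u_X:X\to A^{(A^X)}$ is the map that sends each $x\in X$ to the projection $\pi_x:A^X\to A$.
   Context: Fix a Grothendieck universe $\mathfrak{Small}$, i.e. the set of all sets of rank less than a fixed inaccessible cardinal; its elements are called small sets. A $\mathfrak{Small}$-ary operation on a set $A$ is a map $A^X \to A$ with $X$ a small set (its arity); nullary operations are allowed. A $\mathfrak{Small}$-ary clone on $A$ is a set $F$ of $\mathfrak{Small}$-ary operations on $A$ that contains all projections $\pi_x:A^X\to A$ ($X$ small, $x\in X$) and is such that for all small $X,Y$, every $f:A^Y\to A$ in $F$ and every family $g_y:A^X\to A$ $(y\in Y)$ in $F$, the composite $f\circ(g_y)_{y\in Y}:A^X\to A$ lies in $F$. Operations $f:A^X\to A$ and $g:A^Y\to A$ commute, written $f\perp g$, if for every matrix $a=(a_{xy})\in A^{X\times Y}$ one has $g\bigl((f((a_{xy})_{x\in X}))_{y\in Y}\bigr)=f\bigl((g((a_{xy})_{y\in Y}))_{x\in X}\bigr)$. For a set $G$ of $\mathfrak{Small}$-ary operations on $A$, the $\mathfrak{Small}$-ary centralizer $G^{\perp(\mathfrak{Small})}$ is the set of all $\mathfrak{Small}$-ary operations $f$ on $A$ with $f\perp g$ for all $g\in G$. In $h(f)$, the map $f:A^X\to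 A$ is regarded as an element of $A^{(A^X)}$; and $h\circ u_X:X\to A$ is regarded as an element of $A^X$. -}

module Defs where

open import Level using (Level; suc; _⊔_)
open import Relation.Binary.PropositionalEquality using (_≡_)
open import Relation.Unary using (Pred; _∈_)

private
  variable
    ℓ r : Level

-- The Grothendieck universe of small sets is rendered as the universe Set ℓ
-- (ℓ arbitrary), which contains X → A whenever it contains X and A.

Op : Set ℓ → Set ℓ → Set ℓ
Op A X = (X → A) → A

-- A set of operations of arbitrary small arities, given by its members of
-- each arity.  Like the sets it renders, it need not be small.
OpSet : Set ℓ → (r : Level) → Set (suc (ℓ ⊔ r))
OpSet {ℓ} A r = (X : Set ℓ) → Pred (Op A X) r

π : {A X : Set ℓ} → X → Op A X
π x a = a x

-- The composite f ∘ (g y)_y.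
compose : {A X Y : Set ℓ} → Op A Y → (Y → Op A X) → Op A X
compose f g a = f (λ y → g y a)

record IsClone {A : Set ℓ} (F : OpSet A r) : Set (suc ℓ ⊔ r) where
  field
    projection  : ∀ {X : Set ℓ} (x : X) → π x ∈ F X
    composition : ∀ {X Y : Set ℓ} {f : Op A Y} {g : Y → Op A X} →
                  f ∈ F Y → (∀ y → g y ∈ F X) → compose f g ∈ F X

infix 4 _⊥_

_⊥_ : {A X Y : Set ℓ} → Op A X → Op A Y → Set ℓ
_⊥_ {A = A} {X} {Y} f g = (a : X → Y → A) →
  g (λ y → f (λ x → a x y)) ≡ f (λ x → g (λ y → a x y))

infix 8 _^⊥

_^⊥ : {A : Set ℓ} → OpSet A r → OpSet A (suc ℓ ⊔ r)
_^⊥ {ℓ} {A = A} G X f = ∀ (Y : Set ℓ) (g : Op A Y) → g ∈ G Y → f ⊥ g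

u : (A X : Set ℓ) → X → (X → A) → A
u A X x = π x

-- The forward direction is f ⊥ h at the evaluation matrix (x , b) ↦ b x.
-- Conversely, the columns of a matrix (a x y) for f ⊥ g are points of X → A;
-- composing g with the projections at these columns gives h ∈ G whose
-- equation h f ≡ f (h ∘ u) is exactly the commutation of f and g at that matrix.
{-# OPTIONS --safe #-}
module Submission where

open import Level using (Level)
open import Data.Product using (_,_)
open import Function using (_∘_)
open import Relation.Binary.PropositionalEquality using (_≡_)
open import Relation.Unary using (_∈_; _≐_)
open import Defs

corollary5p5 : ∀ {ℓ r : Level} (A : Set ℓ) (G : OpSet A r) → IsClone G →
    ∀ (X : Set ℓ) →
    (G ^⊥) X ≐ (λ (f : Op A X) → ∀ (h : Op A (X → A)) → h ∈ G (X → A) → h f ≡ f (h ∘ u A X))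
corollary5p5 A G clone X =
    -- Row `x` of this matrix is `u A X x`, and applying `f` down column `b` gives `f b`. By eta
    -- both sides of the commutation are then the required ones definitionally.
    (λ f∈G⊥ h h∈G → f∈G⊥ (X → A) h h∈G (λ x b → b x))
  , (λ eq Y g g∈G a →
       -- This `h` sends `b` to `g (λ y → b (λ x → a x y))`. At `b = f` it yields the left side of
       -- `f ⊥ g`; at `b = π x` it yields `g` of row `x`, so `f (h ∘ u A X)` unfolds to the right
       -- side.
       eq (compose g (λ y → π (λ x → a x y)))
          (composition g∈G (λ y → projection (λ x → a x y))))
  where open IsClone clone
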